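{- Let $(W,S)$ be a finite simply-laced Coxeter system, let $u,v\in W$ with $u<v$, and let $t$ be a minimal element of $AD(u,v)$ with respect to the partial order $\preceq$ on $T$. Then $u\lhd ut\le v$ and $u\le vt\lhd v$.
   Context: $(W,S)$ is finite, realized as a finite reflection group on a real vector space $V$: each reflection $t\in T$ (the set of conjugates of elements of $S$) has a root $\alpha_t$ with $t(\alpha_t)=-\alpha_t$, where the $\alpha_t$ are the positive roots with respect to a fixed fundamental chamber, and the simple roots $\{\alpha_s: s\in S\}$ form a basis of $V$ such that every $\alpha_t$ is a nonnegative linear combination of them. The partial order on $T$ is: $r\preceq t$ iff $\alpha_t-\alpha_r$ is a linear combination of the $\alpha_s$, $s\in S$, with nonnegative coefficients. Simply-laced means $m(s,r)\le 3$ for all $s,r\in S$. $\le$ is Bruhat order, $\ell$ the length, $u\lhd v$ means $u<v$ and $\ell(v)=\ell(u)+1$. $D(u)=\{t\in T: ut<u\}$, $A(u)=\{t\in T: u<ut\}$, $AD(u,v)=A(u)\cap D(v)$. -}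

module Defs where

open import Data.Nat using (ℕ; zero; suc) renaming (_<_ to _<ℕ_)
open import Data.Integer using (ℤ; +_; -_; _+_; _-_; _*_; _≤_; 0ℤ)
open import Data.Fin using (Fin; _≟_)
open import Data.List using (List; []; _∷_; _++_; reverse; length)
open import Data.List.Relation.Unary.Any using (Any)
open import Data.Vec using (Vec; tabulate; lookup; foldr; zipWith; map)
open import Data.Vec.Relation.Unary.All using (All)
open import Data.Product using (Σ; ∃; ∃-syntax; _×_; _,_)
open import Data.Sum using (_⊎_)
open import Data.Bool using (if_then_else_)
open import Relation.Nullary using (¬_; does)
open import Relation.Binary.PropositionalEquality using (_≡_; _≢_)

CoxMat : ℕ → Set
CoxMat n = Fin n → Fin n → ℕ

module Coxeter {n : ℕ} (M : CoxMat n) where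

  IsSimplyLaced : Set
  IsSimplyLaced = (∀ i → M i i ≡ 1)
                × (∀ i j → M i j ≡ M j i)
                × (∀ i j → i ≢ j → (M i j ≡ 2 ⊎ M i j ≡ 3))

  -- 2 B(α_i, α_j) = -2 cos(π / m(i,j)), integral in the simply-laced case.
  cartan : Fin n → Fin n → ℤ
  cartan i j with M i j
  ... | 1 = + 2
  ... | 2 = 0ℤ
  ... | 3 = - (+ 1)
  ... | _ = 0ℤ

  -- Vectors of V written in the basis of simple roots.
  Vect : Set
  Vect = Vec ℤ n

  e : Fin n → Vect
  e i = tabulate λ k → if does (k ≟ i) then + 1 else 0ℤ

  sumV : Vect → ℤ
  sumV = foldr _ _+_ 0ℤ

  pairing : Fin n → Vect → ℤ
  pairing i v = sumV (tabulate λ j → cartan i j * lookup v j)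

  sref : Fin n → Vect → Vect
  sref i v = tabulate λ k → if does (k ≟ i) then lookup v k - pairing i v else lookup v k

  negV : Vect → Vect
  negV = map (λ x → - x)

  subV : Vect → Vect → Vect
  subV = zipWith _-_

  -- Elements of W are represented by words in S; word s₁…s_k acts as s₁ ∘ … ∘ s_k.
  Word : Set
  Word = List (Fin n)

  act : Word → Vect → Vect
  act [] v = v
  act (i ∷ w) v = sref i (act w v)

  -- Equality in W: equal action on V (W is its image in GL(V)).
  _≈_ : Word → Word → Set
  w ≈ w' = ∀ v → act w v ≡ act w' v

  FiniteW : Set
  FiniteW = ∃[ L ] (∀ (w : Word) → Any (w ≈_) L)

  Len : Word → ℕ → Set
  Len w k = (∃[ w' ] (w ≈ w' × length w' ≡ k))
          × (∀ w' → w ≈ w' → k Data.Nat.≤ length w')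

  _ℓ<_ : Word → Word → Set
  x ℓ< y = ∃[ k ] ∃[ m ] (Len x k × Len y m × k <ℕ m)

  IsRefl : Word → Set
  IsRefl t = ∃[ x ] ∃[ i ] (t ≈ (x ++ (i ∷ reverse x)))

  Nonneg : Vect → Set
  Nonneg = All (0ℤ ≤_)

  RootOf : Word → Vect → Set
  RootOf t a = Nonneg a × ∃[ x ] ∃[ i ] (t ≈ (x ++ (i ∷ reverse x))
                 × (a ≡ act x (e i) ⊎ a ≡ negV (act x (e i))))

  _⪯_ : Word → Word → Set
  r ⪯ t = ∃[ a ] ∃[ b ] (RootOf r a × RootOf t b × Nonneg (subV b a))

  -- Bruhat order (Björner–Brenti Def. 2.1.1): reflexive-transitive closure of
  -- w → wt with t ∈ T and ℓ(w) < ℓ(wt).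
  data _≤B_ : Word → Word → Set where
    ≤B-refl : ∀ {u v} → u ≈ v → u ≤B v
    ≤B-step : ∀ {u w v} t → u ≤B w → IsRefl t → w ℓ< (w ++ t) → (w ++ t) ≈ v → u ≤B v

  _<B_ : Word → Word → Set
  u <B v = u ≤B v × ¬ (u ≈ v)

  _⊲_ : Word → Word → Set
  u ⊲ v = u <B v × ∃[ k ] (Len u k × Len v (suc k))

  InA : Word → Word → Set
  InA u t = IsRefl t × u <B (u ++ t)

  InD : Word → Word → Set
  InD u t = IsRefl t × (u ++ t) <B u

  InAD : Word → Word → Word → Set
  InAD u v t = InA u t × InD v t

  MinimalAD : Word → Word → Word → Set
  MinimalAD u v t = InAD u v t × (∀ r → InAD u v r → r ⪯ t → r ≈ t)

{-# OPTIONS --safe #-}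

-- Write (a , b) for the invariant form, and let α be the positive root of t.  Finiteness bounds the
-- coordinates of roots, which forces (a , b) ≤ 1 for distinct roots; hence roots are positive or negative.
-- If u α > 0, then u ⊲ ut exactly when α is no sum β + γ of positive roots with u β and u γ both
-- positive, and minimality of t in AD(u , v) excludes such sums.
-- For ut ≤ v and u ≤ vt, write α = s α′ with α′ = α − α_s of smaller height.  Multiplying u ≤ v on the
-- right by s preserves the order unless s ∈ AD(u , v), which minimality excludes; induction applies to
-- us, vs and α′.  Multiplying back by s can only fail if α′ ∈ AD(u , v), which is excluded likewise.
module Submission where

open import Defs
import Data.Integer.Properties as ℤₚ
open import Algebra.Properties.CommutativeMonoid.Sum ℤₚ.+-0-commutativeMonoid
  using (sum; ∑-comm; ∑-distrib-+; sum-cong-≗; sum-replicate-zero)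
open import Algebra.Properties.Semiring.Sum ℤₚ.+-*-semiring using (*-distribˡ-sum)
open import Data.Bool using (if_then_else_; true; false)
open import Data.Empty using (⊥; ⊥-elim)
open import Data.Fin using (Fin; zero; suc; _≟_)
open import Data.Fin.Properties using (any?)
open import Data.Integer using (ℤ; +_; -[1+_]; -_; _+_; _-_; _*_; _≤_; -≤+; +≤+; _<_; _≤?_; _<?_; 0ℤ; ∣_∣; nonNegative)
open import Data.Integer.Properties hiding (_≟_; _≤?_; _<?_)
open import Data.Integer.Tactic.RingSolver using (solve-∀)
open import Data.List using (List; []; _∷_; _++_; _∷ʳ_; length; reverse)
open import Data.List.Properties using (length-++; unfold-reverse)
open import Data.List.Relation.Unary.Any using (Any; here; there)
open import Data.List.Reverse using (Reverse; []; _∶_∶ʳ_; reverseView)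
open import Data.Nat as ℕ using (ℕ; zero; suc)
open import Data.Product using (∃; ∃-syntax; _×_; _,_; proj₁; proj₂)
open import Data.Sum using (_⊎_; inj₁; inj₂; [_,_])
open import Data.Vec using (Vec; foldr; lookup; tabulate; zipWith)
open import Data.Vec.Properties using (≡-dec; lookup∘tabulate; lookup-map; lookup-zipWith; tabulate-cong; tabulate∘lookup)
open import Data.Vec.Relation.Unary.All.Properties using (lookup⁺; lookup⁻)
open import Function using (_∘_; case_of_)
open import Relation.Binary.PropositionalEquality
  using (_≡_; _≢_; refl; sym; trans; cong; cong₂; subst; subst₂; module ≡-Reasoning)
open import Relation.Nullary using (¬_; Dec; does; yes; no)
import Data.Nat.Properties as ℕₚ

-- Integer sums, coordinates and bounds over finite index sets.

foldr-tabulate : ∀ {n} (f : Fin n → ℤ) → foldr (λ _ → ℤ) _+_ 0ℤ (tabulate f) ≡ sum f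
foldr-tabulate {zero} f = refl
foldr-tabulate {suc n} f = cong (_+_ (f zero)) (foldr-tabulate (f ∘ suc))

sum-sub-scale : ∀ {n} c (f g : Fin n → ℤ) → sum (λ i → f i - c * g i) ≡ sum f - c * sum g
sum-sub-scale {n} c f g = begin
  sum (λ i → f i - c * g i)           ≡⟨ sum-cong-≗ (λ i → cong (_+_ (f i)) (neg-distribˡ-* c (g i))) ⟩
  sum (λ i → f i + (- c) * g i)       ≡⟨ ∑-distrib-+ f _ ⟩
  sum f + sum (λ i → (- c) * g i)     ≡⟨ cong (_+_ (sum f)) (*-distribˡ-sum (- c) g) ⟨
  sum f + (- c) * sum g               ≡⟨ cong (_+_ (sum f)) (neg-distribˡ-* c (sum g)) ⟨
  sum f - c * sum g                   ∎
  where open ≡-Reasoning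

sum-indicator : ∀ {n} (f : Fin n → ℤ) i → sum (λ k → f k * (if does (k ≟ i) then + 1 else 0ℤ)) ≡ f i
sum-indicator {suc n} f zero = trans (cong₂ _+_ (*-identityʳ (f zero))
  (trans (sum-cong-≗ (λ k → *-zeroʳ (f (suc k)))) (sum-replicate-zero n))) (+-identityʳ (f zero))
sum-indicator f (suc i) = trans (cong₂ _+_ (*-zeroʳ (f zero)) (sum-indicator (f ∘ suc) i)) (+-identityˡ (f (suc i)))

sum-nonneg : ∀ {n} {f : Fin n → ℤ} → (∀ i → 0ℤ ≤ f i) → 0ℤ ≤ sum f
sum-nonneg {zero} p = ≤-refl
sum-nonneg {suc n} p = +-mono-≤ (p zero) (sum-nonneg (p ∘ suc))

sum-nonpos : ∀ {n} {f : Fin n → ℤ} → (∀ i → f i ≤ 0ℤ) → sum f ≤ 0ℤ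
sum-nonpos {zero} p = ≤-refl
sum-nonpos {suc n} p = +-mono-≤ (p zero) (sum-nonpos (p ∘ suc))

lookup-ext : ∀ {n} {u v : Vec ℤ n} → (∀ k → lookup u k ≡ lookup v k) → u ≡ v
lookup-ext {u = u} {v} p = trans (sym (tabulate∘lookup u)) (trans (tabulate-cong p) (tabulate∘lookup v))

*-nonneg-nonpos : ∀ {i j} → 0ℤ ≤ i → j ≤ 0ℤ → i * j ≤ 0ℤ
*-nonneg-nonpos {i} {j} 0≤i j≤0 = subst (i * j ≤_) (*-zeroʳ i) (*-monoˡ-≤-nonNeg i {{nonNegative 0≤i}} j≤0)

Fin-bounded : ∀ {m} (f : Fin m → ℕ) → ∃[ N ] ∀ i → f i ℕ.≤ N
Fin-bounded {zero} f = 0 , λ ()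
Fin-bounded {suc m} f with Fin-bounded (f ∘ suc)
... | N , p = f zero ℕ.⊔ N , λ { zero → ℕₚ.m≤m⊔n _ _ ; (suc i) → ℕₚ.≤-trans (p i) (ℕₚ.m≤n⊔m _ _) }

module Roots {n : ℕ} (M : CoxMat n) (simplyLaced : Coxeter.IsSimplyLaced M) (finite : Coxeter.FiniteW M) where
  open Coxeter M

  private variable
    a b c u v w : Vect
    x y z t : Word
    i j s : Fin n
    k m : ℕ

  -- The Cartan matrix and the invariant form.

  cartan-diag : ∀ i → cartan i i ≡ + 2
  cartan-diag i with M i i | proj₁ simplyLaced i
  ... | .1 | refl = refl

  cartan-offdiag : i ≢ j → cartan i j ≤ 0ℤ
  cartan-offdiag {i} {j} i≢j with M i j | proj₂ (proj₂ simplyLaced) i j i≢j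
  ... | .2 | inj₁ refl = ≤-refl
  ... | .3 | inj₂ refl = -≤+

  cartan-sym : ∀ i j → cartan i j ≡ cartan j i
  cartan-sym i j with i ≟ j
  ... | yes refl = refl
  ... | no i≢j with M i j | M j i | proj₁ (proj₂ simplyLaced) i j | proj₂ (proj₂ simplyLaced) i j i≢j
  ... | .2 | .2 | refl | inj₁ refl = refl
  ... | .3 | .3 | refl | inj₂ refl = refl

  infixl 6 _⊖_·_

  abstract
    -- The single operation `u - k v` covers negation (`u = v`, `k = 2`), subtraction (`k = 1`) and
    -- reflections (`k = B a v`), so one linearity lemma for `act` serves all three.
    _⊖_·_ : Vect → ℤ → Vect → Vect
    u ⊖ k · v = zipWith (λ p q → p - k * q) u v

    lookup-⊖ : ∀ u k v i → lookup (u ⊖ k · v) i ≡ lookup u i - k * lookup v i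
    lookup-⊖ u k v i = lookup-zipWith _ i u v

  lookup-e : ∀ i k → lookup (e i) k ≡ (if does (k ≟ i) then + 1 else 0ℤ)
  lookup-e i k = lookup∘tabulate _ k

  -- The W-invariant symmetric form, normalised so that B α α = 2 for every root α.
  abstract
    B : Vect → Vect → ℤ
    B u v = sum (λ i → lookup u i * pairing i v)

    B-expand : ∀ u v → B u v ≡ sum (λ i → lookup u i * pairing i v)
    B-expand u v = refl

  pairing≡sum : ∀ i v → pairing i v ≡ sum (λ j → cartan i j * lookup v j)
  pairing≡sum i v = foldr-tabulate (λ j → cartan i j * lookup v j)

  B-sym : ∀ u v → B u v ≡ B v u
  B-sym u v = begin
    B u v                                                              ≡⟨ expand u v ⟩
    sum (λ i → sum (λ j → lookup u i * (cartan i j * lookup v j)))     ≡⟨ ∑-comm (λ i j → lookup u i * (cartan i j * lookup v j)) ⟩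
    sum (λ j → sum (λ i → lookup u i * (cartan i j * lookup v j)))     ≡⟨ sum-cong-≗ (λ j → sum-cong-≗ (λ i →
                                                                            trans (rearrange (lookup u i) (cartan i j) (lookup v j))
                                                                              (cong (λ m → lookup v j * (m * lookup u i)) (cartan-sym i j)))) ⟩
    sum (λ j → sum (λ i → lookup v j * (cartan j i * lookup u i)))     ≡⟨ expand v u ⟨
    B v u                                                              ∎
    where
    open ≡-Reasoning
    expand : ∀ u v → B u v ≡ sum (λ i → sum (λ j → lookup u i * (cartan i j * lookup v j)))
    expand u v = trans (B-expand u v) (sum-cong-≗ λ i → trans (cong (lookup u i *_) (pairing≡sum i v))
      (*-distribˡ-sum (lookup u i) (λ j → cartan i j * lookup v j)))
    rearrange : ∀ p q r → p * (q * r) ≡ r * (q * p)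
    rearrange = solve-∀

  B-⊖ˡ : ∀ u k v w → B (u ⊖ k · v) w ≡ B u w - k * B v w
  B-⊖ˡ u k v w = trans (B-expand (u ⊖ k · v) w) (trans
    (sum-cong-≗ λ i → trans (cong (_* pairing i w) (lookup-⊖ u k v i)) (distrib (lookup u i) k (lookup v i) (pairing i w)))
    (trans (sum-sub-scale k (λ i → lookup u i * pairing i w) (λ i → lookup v i * pairing i w))
      (sym (cong₂ (λ p q → p - k * q) (B-expand u w) (B-expand v w)))))
    where
    distrib : ∀ p k q r → (p - k * q) * r ≡ p * r - k * (q * r)
    distrib = solve-∀

  B-⊖ʳ : ∀ w u k v → B w (u ⊖ k · v) ≡ B w u - k * B w v
  B-⊖ʳ w u k v = trans (B-sym w _) (trans (B-⊖ˡ u k v w) (cong₂ (λ p q → p - k * q) (B-sym u w) (B-sym v w)))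

  B-e : ∀ i v → B (e i) v ≡ pairing i v
  B-e i v = trans (B-expand (e i) v) (trans (sum-cong-≗ λ k → trans (*-comm _ (pairing k v)) (cong (pairing k v *_) (lookup-e i k)))
    (sum-indicator (λ k → pairing k v) i))

  B-e-e : ∀ i → B (e i) (e i) ≡ + 2
  B-e-e i = begin
    B (e i) (e i)                                  ≡⟨ B-e i (e i) ⟩
    pairing i (e i)                                ≡⟨ pairing≡sum i (e i) ⟩
    sum (λ j → cartan i j * lookup (e i) j)        ≡⟨ sum-cong-≗ (λ j → cong (cartan i j *_) (lookup-e i j)) ⟩
    sum (λ j → cartan i j * (if does (j ≟ i) then + 1 else 0ℤ)) ≡⟨ sum-indicator (cartan i) i ⟩
    cartan i i                                     ≡⟨ cartan-diag i ⟩
    + 2                                            ∎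
    where open ≡-Reasoning

  -- Reflections and the action of words.

  refl[_] : Vect → Vect → Vect
  refl[ a ] v = v ⊖ B a v · a

  sref≡refl : ∀ i v → sref i v ≡ refl[ e i ] v
  sref≡refl i v = lookup-ext λ k → trans (lookup∘tabulate _ k) (trans (go k) (sym (trans (lookup-⊖ v _ (e i) k)
      (cong₂ (λ p q → lookup v k - p * q) (B-e i v) (lookup-e i k)))))
    where
    go : ∀ k → (if does (k ≟ i) then lookup v k - pairing i v else lookup v k)
             ≡ lookup v k - pairing i v * (if does (k ≟ i) then + 1 else 0ℤ)
    go k with does (k ≟ i)
    ... | true = cong (_-_ (lookup v k)) (sym (*-identityʳ _))
    ... | false = sym (trans (cong (_-_ (lookup v k)) (*-zeroʳ (pairing i v))) (+-identityʳ _))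

  refl-⊖ : ∀ a u k v → refl[ a ] (u ⊖ k · v) ≡ refl[ a ] u ⊖ k · refl[ a ] v
  refl-⊖ a u k v = lookup-ext λ i → begin
    lookup (refl[ a ] (u ⊖ k · v)) i                                       ≡⟨ lookup-⊖ (u ⊖ k · v) _ a i ⟩
    lookup (u ⊖ k · v) i - B a (u ⊖ k · v) * lookup a i                    ≡⟨ cong₂ (λ p q → p - q * lookup a i) (lookup-⊖ u k v i) (B-⊖ʳ a u k v) ⟩
    lookup u i - k * lookup v i - (B a u - k * B a v) * lookup a i         ≡⟨ ring (lookup u i) k (lookup v i) (B a u) (B a v) (lookup a i) ⟩
    lookup u i - B a u * lookup a i - k * (lookup v i - B a v * lookup a i) ≡⟨ cong₂ (λ p q → p - k * q) (lookup-⊖ u _ a i) (lookup-⊖ v _ a i) ⟨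
    lookup (refl[ a ] u) i - k * lookup (refl[ a ] v) i                    ≡⟨ lookup-⊖ (refl[ a ] u) k (refl[ a ] v) i ⟨
    lookup (refl[ a ] u ⊖ k · refl[ a ] v) i                               ∎
    where
    open ≡-Reasoning
    ring : ∀ p k q r s t → p - k * q - (r - k * s) * t ≡ p - r * t - k * (q - s * t)
    ring = solve-∀

  B-refl : B a a ≡ + 2 → ∀ u v → B (refl[ a ] u) (refl[ a ] v) ≡ B u v
  B-refl {a} a² u v = begin
    B (u ⊖ B a u · a) (v ⊖ B a v · a)                                      ≡⟨ B-⊖ˡ u _ a _ ⟩
    B u (v ⊖ B a v · a) - B a u * B a (v ⊖ B a v · a)                      ≡⟨ cong₂ (λ p q → p - B a u * q) (B-⊖ʳ u v _ a) (B-⊖ʳ a v _ a) ⟩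
    B u v - B a v * B u a - B a u * (B a v - B a v * B a a)                ≡⟨ cong₂ (λ p q → B u v - B a v * p - B a u * (B a v - B a v * q)) (B-sym u a) a² ⟩
    B u v - B a v * B a u - B a u * (B a v - B a v * + 2)                  ≡⟨ ring (B u v) (B a v) (B a u) ⟩
    B u v                                                                  ∎
    where
    open ≡-Reasoning
    ring : ∀ p q r → p - q * r - r * (q - q * + 2) ≡ p
    ring = solve-∀

  refl-involutive : B a a ≡ + 2 → ∀ v → refl[ a ] (refl[ a ] v) ≡ v
  refl-involutive {a} a² v = lookup-ext λ i → begin
    lookup (refl[ a ] (refl[ a ] v)) i                                     ≡⟨ lookup-⊖ (refl[ a ] v) _ a i ⟩
    lookup (refl[ a ] v) i - B a (refl[ a ] v) * lookup a i                ≡⟨ cong₂ (λ p q → p - q * lookup a i) (lookup-⊖ v _ a i)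
                                                                               (trans (B-⊖ʳ a v _ a) (cong (λ q → B a v - B a v * q) a²)) ⟩
    lookup v i - B a v * lookup a i - (B a v - B a v * + 2) * lookup a i   ≡⟨ ring (lookup v i) (B a v) (lookup a i) ⟩
    lookup v i                                                             ∎
    where
    open ≡-Reasoning
    ring : ∀ p q r → p - q * r - (q - q * + 2) * r ≡ p
    ring = solve-∀

  act-⊖ : ∀ x u k v → act x (u ⊖ k · v) ≡ act x u ⊖ k · act x v
  act-⊖ [] u k v = refl
  act-⊖ (i ∷ x) u k v = begin
    sref i (act x (u ⊖ k · v))                          ≡⟨ cong (sref i) (act-⊖ x u k v) ⟩
    sref i (act x u ⊖ k · act x v)                      ≡⟨ sref≡refl i _ ⟩
    refl[ e i ] (act x u ⊖ k · act x v)                 ≡⟨ refl-⊖ (e i) (act x u) k (act x v) ⟩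
    refl[ e i ] (act x u) ⊖ k · refl[ e i ] (act x v)   ≡⟨ cong₂ (λ p q → p ⊖ k · q) (sref≡refl i _) (sref≡refl i _) ⟨
    sref i (act x u) ⊖ k · sref i (act x v)             ∎
    where open ≡-Reasoning

  B-sref : ∀ i u v → B (sref i u) (sref i v) ≡ B u v
  B-sref i u v = trans (cong₂ B (sref≡refl i u) (sref≡refl i v)) (B-refl (B-e-e i) u v)

  B-act : ∀ x u v → B (act x u) (act x v) ≡ B u v
  B-act [] u v = refl
  B-act (i ∷ x) u v = trans (B-sref i (act x u) (act x v)) (B-act x u v)

  sref-involutive : ∀ i v → sref i (sref i v) ≡ v
  sref-involutive i v = trans (sref≡refl i _) (trans (cong refl[ e i ] (sref≡refl i v)) (refl-involutive (B-e-e i) v))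

  act-++ : ∀ x y v → act (x ++ y) v ≡ act x (act y v)
  act-++ [] y v = refl
  act-++ (i ∷ x) y v = cong (sref i) (act-++ x y v)

  act-reverse : ∀ x v → act x (act (reverse x) v) ≡ v
  act-reverse [] v = refl
  act-reverse (i ∷ x) v = begin
    sref i (act x (act (reverse (i ∷ x)) v))       ≡⟨ cong (λ z → sref i (act x (act z v))) (unfold-reverse i x) ⟩
    sref i (act x (act (reverse x ∷ʳ i) v))        ≡⟨ cong (sref i ∘ act x) (act-++ (reverse x) (i ∷ []) v) ⟩
    sref i (act x (act (reverse x) (sref i v)))    ≡⟨ cong (sref i) (act-reverse x (sref i v)) ⟩
    sref i (sref i v)                              ≡⟨ sref-involutive i v ⟩
    v                                              ∎
    where open ≡-Reasoning

  act-refl : ∀ x a v → act x (refl[ a ] v) ≡ refl[ act x a ] (act x v)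
  act-refl x a v = trans (act-⊖ x v (B a v) a) (cong (λ k → act x v ⊖ k · act x a) (sym (B-act x a v)))

  negV≡⊖ : ∀ v → negV v ≡ v ⊖ + 2 · v
  negV≡⊖ v = lookup-ext λ i → trans (lookup-map i _ v) (trans (ring (lookup v i)) (sym (lookup-⊖ v (+ 2) v i)))
    where
    ring : ∀ p → - p ≡ p - + 2 * p
    ring = solve-∀

  subV≡⊖ : ∀ u v → subV u v ≡ u ⊖ + 1 · v
  subV≡⊖ u v = lookup-ext λ i → trans (lookup-zipWith _ i u v)
    (trans (cong (_-_ (lookup u i)) (sym (*-identityˡ (lookup v i)))) (sym (lookup-⊖ u (+ 1) v i)))

  act-negV : ∀ x v → act x (negV v) ≡ negV (act x v)
  act-negV x v = trans (cong (act x) (negV≡⊖ v)) (trans (act-⊖ x v (+ 2) v) (sym (negV≡⊖ (act x v))))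

  act-subV : ∀ x u v → act x (subV u v) ≡ subV (act x u) (act x v)
  act-subV x u v = trans (cong (act x) (subV≡⊖ u v)) (trans (act-⊖ x u (+ 1) v) (sym (subV≡⊖ (act x u) (act x v))))

  negV-involutive : ∀ v → negV (negV v) ≡ v
  negV-involutive v = lookup-ext λ i → trans (lookup-map i _ (negV v)) (trans (cong -_ (lookup-map i _ v)) (neg-involutive _))

  B-negVˡ : ∀ u v → B (negV u) v ≡ - B u v
  B-negVˡ u v = trans (cong (λ z → B z v) (negV≡⊖ u)) (trans (B-⊖ˡ u (+ 2) u v) (ring (B u v)))
    where
    ring : ∀ p → p - + 2 * p ≡ - p
    ring = solve-∀

  B-negVʳ : ∀ u v → B u (negV v) ≡ - B u v
  B-negVʳ u v = trans (B-sym u _) (trans (B-negVˡ v u) (cong -_ (B-sym v u)))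

  B-subVʳ : ∀ w u v → B w (subV u v) ≡ B w u - B w v
  B-subVʳ w u v = trans (cong (B w) (subV≡⊖ u v)) (trans (B-⊖ʳ w u (+ 1) v) (cong (_-_ (B w u)) (*-identityˡ (B w v))))

  -- Roots.

  Root : Vect → Set
  Root a = ∃[ x ] ∃[ i ] a ≡ act x (e i)

  Root-e : ∀ i → Root (e i)
  Root-e i = [] , i , refl

  Root-act : ∀ x → Root a → Root (act x a)
  Root-act x (y , i , refl) = x ++ y , i , sym (act-++ x y (e i))

  Root-norm : Root a → B a a ≡ + 2
  Root-norm (x , i , refl) = trans (B-act x (e i) (e i)) (B-e-e i)

  refl-self : Root a → refl[ a ] a ≡ negV a
  refl-self {a} ra = trans (cong (λ k → a ⊖ k · a) (Root-norm ra)) (sym (negV≡⊖ a))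

  sref-e : ∀ i → sref i (e i) ≡ negV (e i)
  sref-e i = trans (sref≡refl i (e i)) (refl-self (Root-e i))

  Root-negV : Root a → Root (negV a)
  Root-negV (x , i , refl) = x ++ i ∷ [] , i ,
    trans (sym (act-negV x (e i))) (trans (cong (act x) (sym (sref-e i))) (sym (act-++ x (i ∷ []) (e i))))

  -- Conjugating by `x` moves the root of a reflection by `x`; this turns the words that define `T`
  -- into reflections in roots.
  act-conjugate : ∀ x i v → act (x ++ i ∷ reverse x) v ≡ refl[ act x (e i) ] v
  act-conjugate x i v = begin
    act (x ++ i ∷ reverse x) v                          ≡⟨ act-++ x (i ∷ reverse x) v ⟩
    act x (sref i (act (reverse x) v))                  ≡⟨ cong (act x) (sref≡refl i _) ⟩
    act x (refl[ e i ] (act (reverse x) v))             ≡⟨ act-refl x (e i) _ ⟩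
    refl[ act x (e i) ] (act x (act (reverse x) v))     ≡⟨ cong refl[ act x (e i) ] (act-reverse x v) ⟩
    refl[ act x (e i) ] v                               ∎
    where open ≡-Reasoning

  Root-refl : Root a → Root b → Root (refl[ a ] b)
  Root-refl {b = b} (x , i , refl) rb = subst Root (act-conjugate x i b) (Root-act (x ++ i ∷ reverse x) rb)

  -- Finiteness and inner products of roots.

  abstract
    -- Every word acts as a member of the list, so the largest absolute coordinate met along the
    -- list is a bound.
    coordinates-bounded : (L : List Word) → ∃[ N ] ∀ w → Any (w ≈_) L → ∀ i k → ∣ lookup (act w (e i)) k ∣ ℕ.≤ N
    coordinates-bounded [] = 0 , λ _ ()
    coordinates-bounded (l ∷ L) = proj₁ head ℕ.⊔ proj₁ tail , λ
      { w (here w≈l) i k → subst (λ v → ∣ lookup v k ∣ ℕ.≤ proj₁ head ℕ.⊔ proj₁ tail) (sym (w≈l (e i)))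
          (ℕₚ.≤-trans (proj₂ (row i) k) (ℕₚ.≤-trans (proj₂ head i) (ℕₚ.m≤m⊔n (proj₁ head) (proj₁ tail))))
      ; w (there w∈L) i k → ℕₚ.≤-trans (proj₂ tail w w∈L i k) (ℕₚ.m≤n⊔m (proj₁ head) (proj₁ tail)) }
      where
      row : ∀ i → ∃[ N ] ∀ k → ∣ lookup (act l (e i)) k ∣ ℕ.≤ N
      row i = Fin-bounded (λ k → ∣ lookup (act l (e i)) k ∣)
      head : ∃[ N ] ∀ i → proj₁ (row i) ℕ.≤ N
      head = Fin-bounded (proj₁ ∘ row)
      tail : ∃[ N ] ∀ w → Any (w ≈_) L → ∀ i k → ∣ lookup (act w (e i)) k ∣ ℕ.≤ N
      tail = coordinates-bounded L

    roots-bounded : ∃[ N ] ∀ {a} → Root a → ∀ k → lookup a k ≤ + N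
    roots-bounded = proj₁ bound , λ { (x , i , refl) k → ≤-trans (i≤∣i∣ _) (+≤+ (proj₂ bound x (proj₂ finite x) i k)) }
      where
      bound : ∃[ N ] ∀ w → Any (w ≈_) (proj₁ finite) → ∀ i k → ∣ lookup (act w (e i)) k ∣ ℕ.≤ N
      bound = coordinates-bounded (proj₁ finite)
      i≤∣i∣ : ∀ z → z ≤ + ∣ z ∣
      i≤∣i∣ (+ _) = ≤-refl
      i≤∣i∣ -[1+ _ ] = -≤+

  -- (p , q) ↦ (q , B p q · q − p) keeps B p q and, once B p q ≥ 2, strictly increases
  -- any coordinate in which p < q.
  coordinates-grow : ∀ N k {p q} → Root p → Root q → + 2 ≤ B p q → lookup p k < lookup q k → 0ℤ ≤ lookup q k →
    ∃[ r ] (Root r × + N + lookup q k ≤ lookup r k)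
  coordinates-grow zero k {q = q} _ rq _ _ _ = q , rq , ≤-reflexive (+-identityˡ _)
  coordinates-grow (suc N) k {p} {q} rp rq 2≤pq p<q 0≤q = r , rr ,
    ≤-trans (≤-reflexive (ring (+ N) (lookup q k))) (≤-trans (+-monoʳ-≤ (+ N) 1+q≤q⁺) Nq⁺≤r)
    where
    q⁺ = negV (refl[ q ] p)
    qq⁺ : B q q⁺ ≡ B p q
    qq⁺ = trans (B-negVʳ q _) (trans (cong -_ (trans (B-⊖ʳ q p (B q p) q) (cong (λ m → B q p - B q p * m) (Root-norm rq))))
      (trans (negate (B q p)) (B-sym q p)))
      where
      negate : ∀ m → - (m - m * + 2) ≡ m
      negate = solve-∀
    lookup-q⁺ : lookup q⁺ k ≡ - (lookup p k - B p q * lookup q k)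
    lookup-q⁺ = trans (lookup-map k _ (refl[ q ] p)) (cong -_ (trans (lookup-⊖ p (B q p) q k)
      (cong (λ m → lookup p k - m * lookup q k) (B-sym q p))))
    1+q≤q⁺ : + 1 + lookup q k ≤ lookup q⁺ k
    -- In the k-th coordinate `q⁺ - (1 + q)` equals `(B p q - 2) q + (q - (1 + p))`, a sum of two
    -- nonnegative terms.
    1+q≤q⁺ = 0≤i-j⇒j≤i (subst (0ℤ ≤_)
      (trans (difference (B p q) (lookup q k) (lookup p k)) (cong (_- (+ 1 + lookup q k)) (sym lookup-q⁺)))
      (+-mono-≤ (subst (_≤ (B p q - + 2) * lookup q k) (*-zeroʳ (B p q - + 2))
                  (*-monoˡ-≤-nonNeg (B p q - + 2) {{nonNegative (i≤j⇒0≤j-i 2≤pq)}} 0≤q))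
                (i≤j⇒0≤j-i (i<j⇒suc[i]≤j p<q))))
      where
      difference : ∀ c f g → (c - + 2) * f + (f - (+ 1 + g)) ≡ - (g - c * f) - (+ 1 + f)
      difference = solve-∀
    q<q⁺ : lookup q k < lookup q⁺ k
    q<q⁺ = suc[i]≤j⇒i<j 1+q≤q⁺
    further = coordinates-grow N k rq (Root-negV (Root-refl rq rp)) (subst (+ 2 ≤_) (sym qq⁺) 2≤pq) q<q⁺
      (≤-trans 0≤q (<⇒≤ q<q⁺))
    r = proj₁ further
    rr = proj₁ (proj₂ further)
    Nq⁺≤r = proj₂ (proj₂ further)
    ring : ∀ m f → + 1 + m + f ≡ m + (+ 1 + f)
    ring = solve-∀

  -- Otherwise the growth argument yields a root beyond the bound. It needs a nonnegative coordinate
  -- of `q`; if that fails, the pair `(negV q , negV p)` has the same product and the same strict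
  -- inequality, and qualifies.
  coordinates-≮ : ∀ k {p q} → Root p → Root q → + 2 ≤ B p q → ¬ lookup p k < lookup q k
  coordinates-≮ k {p} {q} rp rq 2≤pq p<q = [ unbounded rp rq 2≤pq p<q , unbounded (Root-negV rq) (Root-negV rp) 2≤-q-p -q<-p ∘ flip ] sign
    where
    unbounded : ∀ {p q} → Root p → Root q → + 2 ≤ B p q → lookup p k < lookup q k → ¬ 0ℤ ≤ lookup q k
    unbounded {p} {q} rp rq 2≤pq p<q 0≤q = ℕₚ.1+n≰n (drop‿+≤+ (≤-trans (i≤i+j (+ suc N) (lookup q k) {{nonNegative 0≤q}})
      (≤-trans (proj₂ (proj₂ further)) (proj₂ roots-bounded (proj₁ (proj₂ further)) k))))
      where
      N : ℕ
      N = proj₁ roots-bounded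
      further = coordinates-grow (suc N) k rp rq 2≤pq p<q 0≤q
    sign : 0ℤ ≤ lookup q k ⊎ lookup q k ≤ 0ℤ
    sign = ≤-total 0ℤ (lookup q k)
    2≤-q-p : + 2 ≤ B (negV q) (negV p)
    2≤-q-p = subst (+ 2 ≤_) (sym (trans (B-negVˡ q _) (trans (cong -_ (B-negVʳ q p)) (trans (neg-involutive _) (B-sym q p))))) 2≤pq
    -q<-p : lookup (negV q) k < lookup (negV p) k
    -q<-p = subst₂ _<_ (sym (lookup-map k _ q)) (sym (lookup-map k _ p)) (neg-mono-< p<q)
    flip : lookup q k ≤ 0ℤ → 0ℤ ≤ lookup (negV p) k
    flip q≤0 = subst (0ℤ ≤_) (sym (lookup-map k _ p)) (neg-mono-≤ (≤-trans (<⇒≤ p<q) q≤0))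

  -- The pair is ruled out in both orders, so no coordinate differs. Finiteness thus supplies the
  -- equality case of Cauchy-Schwarz.
  B≥2⇒≡ : ∀ {p q} → Root p → Root q → + 2 ≤ B p q → p ≡ q
  B≥2⇒≡ {p} {q} rp rq 2≤pq = lookup-ext λ k → ≤-antisym
    (≮⇒≥ (coordinates-≮ k rq rp (subst (+ 2 ≤_) (B-sym p q) 2≤pq)))
    (≮⇒≥ (coordinates-≮ k rp rq 2≤pq))

  B≤1 : ∀ {p q} → Root p → Root q → p ≢ q → B p q ≤ + 1
  B≤1 rp rq p≢q = ≮⇒≥ λ 1<pq → p≢q (B≥2⇒≡ rp rq (i<j⇒suc[i]≤j 1<pq))

  -- Positive and negative roots.

  _≟ᵥ_ : (a b : Vect) → Dec (a ≡ b)
  _≟ᵥ_ = ≡-dec ℤₚ._≟_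

  Nonneg-e : ∀ i → Nonneg (e i)
  Nonneg-e i = lookup⁻ λ k → subst (0ℤ ≤_) (sym (lookup-e i k)) (go k)
    where
    go : ∀ k → 0ℤ ≤ (if does (k ≟ i) then + 1 else 0ℤ)
    go k with does (k ≟ i)
    ... | true = +≤+ ℕ.z≤n
    ... | false = ≤-refl

  -- The only coordinate that changes is the j-th, by − B (e j) b.  If the j-th coordinate of b vanishes then B (e j) b ≤ 0, and otherwise B (e j) b ≤ 1.
  sref-nonneg : Root b → Nonneg b → b ≢ e j → Nonneg (sref j b)
  sref-nonneg {b} {j} rb 0≤b b≢ej = lookup⁻ λ k → subst (0ℤ ≤_) (sym (lookup∘tabulate _ k)) (coordinate k)
    where
    term : lookup b j ≤ 0ℤ → ∀ m → cartan j m * lookup b m ≤ 0ℤ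
    term bj≤0 m with j ≟ m
    ... | yes refl = ≤-reflexive (trans (cong (cartan j j *_) (≤-antisym bj≤0 (lookup⁺ 0≤b j))) (*-zeroʳ (cartan j j)))
    ... | no j≢m = subst (_≤ 0ℤ) (*-comm (lookup b m) (cartan j m)) (*-nonneg-nonpos (lookup⁺ 0≤b m) (cartan-offdiag j≢m))
    pairing≤ : pairing j b ≤ lookup b j
    pairing≤ with lookup b j ≤? 0ℤ
    ... | yes bj≤0 = ≤-trans (subst (_≤ 0ℤ) (sym (pairing≡sum j b)) (sum-nonpos (term bj≤0))) (lookup⁺ 0≤b j)
    ... | no bj≰0 = ≤-trans (subst (_≤ + 1) (B-e j b) (B≤1 (Root-e j) rb (b≢ej ∘ sym))) (i<j⇒suc[i]≤j (≰⇒> bj≰0))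
    coordinate : ∀ k → 0ℤ ≤ (if does (k ≟ j) then lookup b k - pairing j b else lookup b k)
    coordinate k with k ≟ j
    ... | yes refl = i≤j⇒0≤j-i pairing≤
    ... | no _ = lookup⁺ 0≤b k

  Nonneg-sref-dichotomy : ∀ i → Root a → Nonneg a → Nonneg (sref i a) ⊎ Nonneg (negV (sref i a))
  Nonneg-sref-dichotomy {a} i ra 0≤a with a ≟ᵥ e i
  ... | yes refl = inj₂ (subst Nonneg (sym (trans (cong negV (sref-e i)) (negV-involutive (e i)))) 0≤a)
  ... | no a≢ei = inj₁ (sref-nonneg ra 0≤a a≢ei)

  -- Induction along the word: a simple reflection keeps a positive root positive except for its own
  -- simple root, which it negates; negative roots follow by negation.
  root-sign : Root a → Nonneg a ⊎ Nonneg (negV a)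
  root-sign (x , i , refl) = go x
    where
    go : ∀ x → Nonneg (act x (e i)) ⊎ Nonneg (negV (act x (e i)))
    go [] = inj₁ (Nonneg-e i)
    go (s ∷ x) with go x
    ... | inj₁ 0≤a = Nonneg-sref-dichotomy s (x , i , refl) 0≤a
    ... | inj₂ a≤0 with Nonneg-sref-dichotomy s (Root-negV (x , i , refl)) a≤0
    ...   | inj₁ p = inj₂ (subst Nonneg (act-negV (s ∷ []) (act x (e i))) p)
    ...   | inj₂ p = inj₁ (subst Nonneg (trans (cong negV (act-negV (s ∷ []) (act x (e i)))) (negV-involutive _)) p)

  -- With both signs all coordinates vanish, against `B a a = 2`.
  root-sign-exclusive : Root a → Nonneg a → ¬ Nonneg (negV a)
  root-sign-exclusive {a} ra 0≤a a≤0 = case subst (_≤ 0ℤ) (trans (sym (B-expand a a)) (Root-norm ra)) (sum-nonpos term) of λ { (+≤+ ()) }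
    where
    zeros : ∀ i → lookup a i ≡ 0ℤ
    zeros i = ≤-antisym (subst (_≤ 0ℤ) (neg-involutive (lookup a i)) (neg-mono-≤ (subst (0ℤ ≤_) (lookup-map i _ a) (lookup⁺ a≤0 i)))) (lookup⁺ 0≤a i)
    term : ∀ i → lookup a i * pairing i a ≤ 0ℤ
    term i = ≤-reflexive (cong (_* pairing i a) (zeros i))

  -- Height and depth of positive roots.

  -- A positive root reached from a simple one by steps a ↦ s a = a + α_s.
  data Depth : Vect → Set where
    simple : ∀ i → Depth (e i)
    climb : ∀ s {a} → Root a → Nonneg a → B (e s) a ≡ - + 1 → Depth a → Depth (sref s a)

  sum-sref : ∀ i a → sum (lookup (sref i a)) ≡ sum (lookup a) - B (e i) a
  sum-sref i a = begin
    sum (lookup (sref i a))                                   ≡⟨ cong (sum ∘ lookup) (sref≡refl i a) ⟩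
    sum (lookup (refl[ e i ] a))                              ≡⟨ sum-cong-≗ (lookup-⊖ a (B (e i) a) (e i)) ⟩
    sum (λ k → lookup a k - B (e i) a * lookup (e i) k)       ≡⟨ sum-sub-scale (B (e i) a) (lookup a) (lookup (e i)) ⟩
    sum (lookup a) - B (e i) a * sum (lookup (e i))           ≡⟨ cong (λ m → sum (lookup a) - B (e i) a * m) height-e ⟩
    sum (lookup a) - B (e i) a * + 1                          ≡⟨ cong (_-_ (sum (lookup a))) (*-identityʳ _) ⟩
    sum (lookup a) - B (e i) a                                ∎
    where
    open ≡-Reasoning
    height-e : sum (lookup (e i)) ≡ + 1
    height-e = trans (sum-cong-≗ λ k → trans (lookup-e i k) (sym (*-identityˡ _))) (sum-indicator (λ _ → + 1) i)

  -- `B a a = 2` is the sum of the coordinates of `a` times the products `B (e i) a`; the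
  -- coordinates are nonnegative, so some product is positive, and it is at most 1 since `a` is not
  -- simple.
  descent : Root a → Nonneg a → (∀ i → a ≢ e i) → ∃[ s ] B (e s) a ≡ + 1
  descent {a} ra 0≤a nonsimple with any? (λ i → 0ℤ <? B (e i) a)
  ... | yes (s , 0<) = s , ≤-antisym (B≤1 (Root-e s) ra (nonsimple s ∘ sym)) (i<j⇒suc[i]≤j 0<)
  ... | no none = ⊥-elim (case subst (_≤ 0ℤ) (trans (sym (B-expand a a)) (Root-norm ra))
      (sum-nonpos λ i → *-nonneg-nonpos (lookup⁺ 0≤a i) (subst (_≤ 0ℤ) (B-e i a) (≮⇒≥ (λ 0< → none (i , 0<))))) of λ { (+≤+ ()) })

  sref-flip : ∀ s {m} → B (e s) a ≡ m → B (e s) (sref s a) ≡ - m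
  sref-flip {a} s p = trans (sym (B-sref s (e s) (sref s a))) (trans (cong₂ B (sref-e s) (sref-involutive s a)) (trans (B-negVˡ (e s) a) (cong -_ p)))

  depth : Root a → Nonneg a → Depth a
  -- The recursion runs on a bound for the height, initially the height itself; each descent lowers
  -- it by exactly 1.
  depth {a} ra 0≤a = go ∣ sum (lookup a) ∣ ra 0≤a (≤-reflexive (sym (0≤i⇒+∣i∣≡i (sum-nonneg (lookup⁺ 0≤a)))))
    where
    go : ∀ m {a} → Root a → Nonneg a → sum (lookup a) ≤ + m → Depth a
    go m {a} ra 0≤a height≤m with any? (λ i → a ≟ᵥ e i)
    ... | yes (i , refl) = simple i
    ... | no nonsimple with descent ra 0≤a (λ i a≡ei → nonsimple (i , a≡ei))
    ...   | s , sa≡1 = subst Depth (sref-involutive s a) (climb s ra⁻ 0≤a⁻ (sref-flip s sa≡1) (lower m height≤m))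
      where
      ra⁻ : Root (sref s a)
      ra⁻ = Root-act (s ∷ []) ra
      0≤a⁻ : Nonneg (sref s a)
      0≤a⁻ = sref-nonneg ra 0≤a (λ a≡es → nonsimple (s , a≡es))
      height : sum (lookup (sref s a)) ≡ sum (lookup a) - + 1
      height = trans (sum-sref s a) (cong (_-_ (sum (lookup a))) sa≡1)
      lower : ∀ m → sum (lookup a) ≤ + m → Depth (sref s a)
      -- A height at most 0 would leave the nonnegative vector `sref s a` with a negative coordinate
      -- sum.
      lower zero h≤0 = case ≤-trans (subst (0ℤ ≤_) height (sum-nonneg (lookup⁺ 0≤a⁻))) (+-monoˡ-≤ (- + 1) h≤0) of λ ()
      lower (suc m) h≤m = go m ra⁻ 0≤a⁻ (subst (_≤ + m) (sym height) (+-monoˡ-≤ (- + 1) h≤m))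

  -- Exchange and the length function.

  Neg : Vect → Set
  Neg a = Nonneg (negV a)

  neg-negV : Nonneg a → Neg (negV a)
  neg-negV {a} = subst Nonneg (sym (negV-involutive a))

  Nonneg-subV : Nonneg a → Neg b → Nonneg (subV a b)
  Nonneg-subV {a} {b} 0≤a b≤0 = lookup⁻ λ i → subst (0ℤ ≤_) (sym (lookup-zipWith _-_ i a b))
    (+-mono-≤ (lookup⁺ 0≤a i) (subst (0ℤ ≤_) (lookup-map i _ b) (lookup⁺ b≤0 i)))

  Neg-subV : Neg a → Nonneg b → Neg (subV a b)
  Neg-subV {a} {b} a≤0 0≤b = subst Nonneg (lookup-ext eq) (Nonneg-subV a≤0 (neg-negV 0≤b))
    where
    eq : ∀ i → lookup (subV (negV a) (negV b)) i ≡ lookup (negV (subV a b)) i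
    eq i = trans (lookup-zipWith _-_ i (negV a) (negV b)) (trans (cong₂ _-_ (lookup-map i _ a) (lookup-map i _ b))
      (trans (ring (lookup a i) (lookup b i)) (sym (trans (lookup-map i _ (subV a b)) (cong -_ (lookup-zipWith _-_ i a b))))))
      where
      ring : ∀ p q → - p - - q ≡ - (p - q)
      ring = solve-∀

  -- Reading the word from the right, the image of `a` starts positive and ends negative. It changes
  -- sign at a letter `i` exactly when it equals `e i`, and deleting that letter amounts to
  -- inserting the reflection in `a`.
  exchange : Root a → Nonneg a → ∀ w → Neg (act w a) →
    ∃[ w′ ] (length w ≡ suc (length w′) × ∀ v → act w′ v ≡ act w (refl[ a ] v))
  exchange ra 0≤a [] a≤0 = ⊥-elim (root-sign-exclusive ra 0≤a a≤0)
  exchange {a} ra 0≤a (i ∷ w) iwa≤0 with root-sign (Root-act w ra)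
  ... | inj₂ wa≤0 with exchange ra 0≤a w wa≤0
  ...   | w′ , |w|≡ , eq = i ∷ w′ , cong suc |w|≡ , λ v → cong (sref i) (eq v)
  exchange {a} ra 0≤a (i ∷ w) iwa≤0 | inj₁ 0≤wa with act w a ≟ᵥ e i
  ... | no wa≢ei = ⊥-elim (root-sign-exclusive (Root-act (i ∷ w) ra) (sref-nonneg (Root-act w ra) 0≤wa wa≢ei) iwa≤0)
  ... | yes wa≡ei = w , refl , λ v → sym (begin
    sref i (act w (refl[ a ] v))             ≡⟨ cong (sref i) (act-refl w a v) ⟩
    sref i (refl[ act w a ] (act w v))       ≡⟨ cong (λ b → sref i (refl[ b ] (act w v))) wa≡ei ⟩
    sref i (refl[ e i ] (act w v))           ≡⟨ cong (sref i) (sref≡refl i (act w v)) ⟨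
    sref i (sref i (act w v))                ≡⟨ sref-involutive i (act w v) ⟩
    act w v                                  ∎)
    where open ≡-Reasoning

  -- This says `y = x t` in W for the reflection `t` in `a`. Phrasing it by actions leaves the
  -- choice of the word `y` free.
  Reflected : Word → Vect → Word → Set
  Reflected x a y = ∀ v → act y v ≡ act x (refl[ a ] v)

  Reflected-sym : Root a → Reflected x a y → Reflected y a x
  Reflected-sym {a} {x} ra xy v = trans (cong (act x) (sym (refl-involutive (Root-norm ra) v))) (sym (xy (refl[ a ] v)))

  Reflected-negates : Root a → Reflected x a y → act y a ≡ negV (act x a)
  Reflected-negates {a} {x} ra xy = trans (xy a) (trans (cong (act x) (refl-self ra)) (act-negV x a))

  Reflected-snoc : ∀ x s → Reflected x (e s) (x ∷ʳ s)
  Reflected-snoc x s v = trans (act-++ x (s ∷ []) v) (cong (act x) (sref≡refl s v))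

  act-snoc : ∀ x s v → act (x ∷ʳ s) v ≡ act x (sref s v)
  act-snoc x s v = act-++ x (s ∷ []) v

  act-snoc-e : ∀ x s → act (x ∷ʳ s) (e s) ≡ negV (act x (e s))
  act-snoc-e x s = Reflected-negates {x = x} {y = x ∷ʳ s} (Root-e s) (Reflected-snoc x s)

  snoc-snoc : ∀ x s → ((x ∷ʳ s) ∷ʳ s) ≈ x
  snoc-snoc x s v = trans (act-snoc (x ∷ʳ s) s v) (trans (act-snoc x s (sref s v)) (cong (act x) (sref-involutive s v)))

  -- The reflection in `sref s a` is the conjugate by `s` of the reflection in `a`. This is what
  -- lets the inductions on depth pass from `x`, `y` to `x ∷ʳ s`, `y ∷ʳ s`.
  Reflected-conjugate : Reflected x (sref s a) y → Reflected (x ∷ʳ s) a (y ∷ʳ s)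
  Reflected-conjugate {x} {s} {a} {y} xy v = begin
    act (y ∷ʳ s) v                                ≡⟨ act-snoc y s v ⟩
    act y (sref s v)                              ≡⟨ xy (sref s v) ⟩
    act x (refl[ sref s a ] (sref s v))           ≡⟨ cong (act x) (act-refl (s ∷ []) a v) ⟨
    act x (sref s (refl[ a ] v))                  ≡⟨ act-snoc x s (refl[ a ] v) ⟨
    act (x ∷ʳ s) (refl[ a ] v)                    ∎
    where open ≡-Reasoning

  length-snoc : ∀ (x : Word) s → length (x ∷ʳ s) ≡ suc (length x)
  length-snoc x s = trans (length-++ x) (ℕₚ.+-comm (length x) 1)

  Len-cong : x ≈ y → Len x k → Len y k
  Len-cong x≈y ((w , x≈w , |w|≡k) , min) =
    (w , (λ v → trans (sym (x≈y v)) (x≈w v)) , |w|≡k) , λ w′ y≈w′ → min w′ λ v → trans (x≈y v) (y≈w′ v)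

  -- Exchange in a shortest word for `x` gives a word for `y` with one letter fewer.
  Len-shorter : Root a → Nonneg a → Reflected x a y → Neg (act x a) → Len x k → Len y m → m ℕ.< k
  Len-shorter {a} ra 0≤a xy xa≤0 ((w , x≈w , refl) , _) (_ , min)
    with exchange ra 0≤a w (subst Neg (x≈w a) xa≤0)
  ... | w′ , |w|≡ , eq = subst (_ ℕ.<_) (sym |w|≡)
    (ℕ.s≤s (min w′ λ v → trans (xy v) (trans (x≈w (refl[ a ] v)) (sym (eq v)))))

  Len-longer : Root a → Nonneg a → Reflected x a y → Nonneg (act x a) → Len x k → Len y m → k ℕ.< m
  Len-longer {x = x} {y} ra 0≤a xy 0≤xa lx ly = Len-shorter {x = y} {x} ra 0≤a (Reflected-sym {x = x} {y} ra xy)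
    (subst Neg (sym (Reflected-negates {x = x} {y} ra xy)) (neg-negV 0≤xa)) ly lx

  -- Appending `s` gives the upper bound. Conversely `y` negates `e s`, so exchange removes a letter
  -- from any word for `y` and leaves a word for `x`.
  Len-up : Nonneg (act x (e s)) → Reflected x (e s) y → Len x k → Len y (suc k)
  Len-up {x} {s} {y} 0≤xs xy ((w , x≈w , refl) , min) =
    (w ∷ʳ s , (λ v → trans (xy v) (trans (x≈w _) (sym (Reflected-snoc w s v)))) , length-snoc w s) , min′
    where
    min′ : ∀ w′ → y ≈ w′ → suc (length w) ℕ.≤ length w′
    min′ w′ y≈w′ with exchange (Root-e s) (Nonneg-e s) w′
      (subst Neg (trans (sym (Reflected-negates {x = x} {y} (Root-e s) xy)) (y≈w′ (e s))) (neg-negV 0≤xs))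
    ... | w″ , |w′|≡ , eq = subst (suc (length w) ℕ.≤_) (sym |w′|≡) (ℕ.s≤s (min w″ λ v →
      trans (Reflected-sym {x = x} {y} (Root-e s) xy v) (trans (y≈w′ _) (sym (eq v)))))

  Len-down : Neg (act x (e s)) → Reflected x (e s) y → Len x k → ∃[ m ] (k ≡ suc m × Len y m)
  Len-down {x} {s} {y} xs≤0 xy ((w , x≈w , refl) , min)
    with exchange (Root-e s) (Nonneg-e s) w (subst Neg (x≈w (e s)) xs≤0)
  ... | w′ , |w|≡ , eq = length w′ , |w|≡ ,
    (w′ , (λ v → trans (xy v) (trans (x≈w _) (sym (eq v)))) , refl) , min′
    where
    min′ : ∀ z → y ≈ z → length w′ ℕ.≤ length z
    min′ z y≈z = ℕ.s≤s⁻¹ (subst₂ ℕ._≤_ |w|≡ (length-snoc z s) (min (z ∷ʳ s) λ v →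
      trans (Reflected-sym {x = x} {y} (Root-e s) xy v) (trans (y≈z _) (sym (Reflected-snoc z s v)))))

  -- Length is given as a relation, so a value has to be produced; the last letter raises or lowers
  -- it by one according to the sign of the image of its simple root.
  Len-exists : ∀ x → ∃ (Len x)
  Len-exists x = go (reverseView x)
    where
    go : ∀ {w} → Reverse w → ∃ (Len w)
    go [] = 0 , ([] , (λ _ → refl) , refl) , λ _ _ → ℕ.z≤n
    go (x ∶ rx ∶ʳ s) with go rx | root-sign (Root-act x (Root-e s))
    ... | k , lx | inj₁ 0≤xs = suc k , Len-up {x = x} {y = x ∷ʳ s} 0≤xs (Reflected-snoc x s) lx
    ... | k , lx | inj₂ xs≤0 with Len-down {x = x} {y = x ∷ʳ s} xs≤0 (Reflected-snoc x s) lx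
    ...   | m , _ , ly = m , ly

  -- Edges of the Bruhat graph.

  -- Positivity of the image of the label replaces the length inequality in a Bruhat step; `≤B-edge`
  -- and `step-edge` translate between the two.
  record Edge (x y : Word) : Set where
    constructor edge
    field
      {label} : Vect
      label-root : Root label
      label-nonneg : Nonneg label
      image-nonneg : Nonneg (act x label)
      reflected : Reflected x label y

  rootWord : Root a → Word
  rootWord (x , i , _) = x ++ i ∷ reverse x

  act-rootWord : (ra : Root a) → ∀ v → act (rootWord ra) v ≡ refl[ a ] v
  act-rootWord (x , i , refl) = act-conjugate x i

  Reflected-++ : (∀ v → act t v ≡ refl[ a ] v) → ∀ x → Reflected x a (x ++ t)
  Reflected-++ {t} t≈ x v = trans (act-++ x t v) (cong (act x) (t≈ v))

  ≤B-edge : z ≤B x → Edge x y → z ≤B y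
  ≤B-edge {x = x} {y} u≤x (edge ra@(z , i , _) 0≤a 0≤xa xy) =
    ≤B-step τ u≤x (z , i , λ _ → refl)
      (_ , _ , proj₂ (Len-exists x) , proj₂ (Len-exists (x ++ τ)) ,
        Len-longer {x = x} {x ++ τ} ra 0≤a xt 0≤xa (proj₂ (Len-exists x)) (proj₂ (Len-exists (x ++ τ))))
      (λ v → trans (xt v) (sym (xy v)))
    where
    τ : Word
    τ = rootWord ra
    xt : Reflected x _ (x ++ τ)
    xt = Reflected-++ {τ} (act-rootWord ra) x

  refl-negV : ∀ a v → refl[ negV a ] v ≡ refl[ a ] v
  refl-negV a v = lookup-ext λ i → trans (lookup-⊖ v (B (negV a) v) (negV a) i)
    (trans (cong₂ (λ p q → lookup v i - p * q) (B-negVˡ a v) (lookup-map i _ a))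
      (trans (ring (lookup v i) (B a v) (lookup a i)) (sym (lookup-⊖ v (B a v) a i))))
    where
    ring : ∀ p q r → p - (- q) * (- r) ≡ p - q * r
    ring = solve-∀

  positiveRoot : IsRefl t → ∃[ a ] (Root a × RootOf t a × ∀ v → act t v ≡ refl[ a ] v)
  positiveRoot {t} (x , i , t≈) with root-sign (x , i , refl)
  ... | inj₁ 0≤a = act x (e i) , (x , i , refl) , (0≤a , x , i , t≈ , inj₁ refl) , λ v → trans (t≈ v) (act-conjugate x i v)
  ... | inj₂ a≤0 = negV (act x (e i)) , Root-negV (x , i , refl) , (a≤0 , x , i , t≈ , inj₂ refl) ,
    λ v → trans (t≈ v) (trans (act-conjugate x i v) (sym (refl-negV (act x (e i)) v)))

  -- If the image of the positive root were negative, `Len-shorter` would contradict the increase in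
  -- length.
  step-edge : IsRefl t → x ℓ< (x ++ t) → (x ++ t) ≈ y → Edge x y
  step-edge {t} {x} t-refl (k , m , lx , lxt , k<m) xt≈y with positiveRoot {t} t-refl
  ... | a , ra , (0≤a , _) , t≈ with root-sign (Root-act x ra)
  ...   | inj₁ 0≤xa = edge ra 0≤a 0≤xa (λ v → trans (sym (xt≈y v)) (Reflected-++ {t} t≈ x v))
  ...   | inj₂ xa≤0 = ⊥-elim (ℕₚ.<-asym k<m (Len-shorter {x = x} {x ++ t} ra 0≤a (Reflected-++ {t} t≈ x) xa≤0 lx lxt))

  edge-Len : Edge x y → Len x k → Len y m → k ℕ.< m
  edge-Len {x} {y} (edge ra 0≤a 0≤xa xy) = Len-longer {x = x} {y} ra 0≤a xy 0≤xa

  ≤B-Len : x ≤B y → Len x k → Len y m → k ℕ.≤ m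
  ≤B-Len (≤B-refl x≈y) (_ , min) ((w , y≈w , refl) , _) = min w λ v → trans (x≈y v) (y≈w v)
  ≤B-Len {y = y} (≤B-step {w = w} t x≤w t-refl shorter wt≈y) lx ly = ℕₚ.≤-trans (≤B-Len x≤w lx (proj₂ (Len-exists w)))
    (ℕₚ.<⇒≤ (edge-Len (step-edge {t} {w} {y} t-refl shorter wt≈y) (proj₂ (Len-exists w)) ly))

  ≤B-resp-≈ : x ≤B y → y ≈ z → x ≤B z
  ≤B-resp-≈ (≤B-refl x≈y) y≈z = ≤B-refl λ v → trans (x≈y v) (y≈z v)
  ≤B-resp-≈ (≤B-step t x≤w r shorter wt≈y) y≈z = ≤B-step t x≤w r shorter λ v → trans (wt≈y v) (y≈z v)

  ≤B-trans : x ≤B y → y ≤B z → x ≤B z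
  ≤B-trans x≤y (≤B-refl y≈z) = ≤B-resp-≈ x≤y y≈z
  ≤B-trans x≤y (≤B-step t y≤w r shorter wt≈z) = ≤B-step t (≤B-trans x≤y y≤w) r shorter wt≈z

  edge-≤B : Edge x y → x ≤B y
  edge-≤B = ≤B-edge (≤B-refl λ _ → refl)

  -- Right multiplication by a simple reflection.

  -- The reflection `s` permutes the positive roots other than `e s`, so the label moves to its
  -- image under `s`. An edge labelled `e s` is the only exception.
  edge-snoc : ∀ s → Edge x y → Edge (x ∷ʳ s) (y ∷ʳ s) ⊎ (x ∷ʳ s) ≈ y
  edge-snoc {x} {y} s (edge {a} ra 0≤a 0≤xa xy) with a ≟ᵥ e s
  ... | yes refl = inj₂ λ v → trans (Reflected-snoc x s v) (sym (xy v))
  ... | no a≢es = inj₁ (edge (Root-act (s ∷ []) ra) (sref-nonneg ra 0≤a a≢es)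
    (subst Nonneg (sym (trans (act-snoc x s (sref s a)) (cong (act x) (sref-involutive s a)))) 0≤xa)
    (Reflected-conjugate {x} {s} {sref s a} {y} (subst (λ b → Reflected x b y) (sym (sref-involutive s a)) xy)))

  -- The chain is multiplied edge by edge from the bottom. At an exceptional edge `w ∷ʳ s` is the
  -- upper end itself, and the rest of the chain is kept unmultiplied.
  ≤B-snocˡ : ∀ s → x ≤B y → (x ∷ʳ s) ≤B (y ∷ʳ s) ⊎ (x ∷ʳ s) ≤B y
  ≤B-snocˡ {x} {y} s (≤B-refl x≈y) = inj₁ (≤B-refl λ v → trans (act-snoc x s v) (trans (x≈y (sref s v)) (sym (act-snoc y s v))))
  ≤B-snocˡ s (≤B-step {w = w} t x≤w r shorter wt≈y) with step-edge {t} {w} r shorter wt≈y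
  ... | w→y with ≤B-snocˡ s x≤w
  ...   | inj₂ xs≤w = inj₂ (≤B-edge xs≤w w→y)
  ...   | inj₁ xs≤ws with edge-snoc s w→y
  ...     | inj₁ ws→ys = inj₁ (≤B-edge xs≤ws ws→ys)
  ...     | inj₂ ws≈y = inj₂ (≤B-resp-≈ xs≤ws ws≈y)

  -- Here multiplication starts from the top: at an exceptional edge the lower end `w` is `y ∷ʳ s`,
  -- and the chain below it is kept unmultiplied.
  ≤B-snocʳ : ∀ s → x ≤B y → (x ∷ʳ s) ≤B (y ∷ʳ s) ⊎ x ≤B (y ∷ʳ s)
  ≤B-snocʳ {x} {y} s (≤B-refl x≈y) = inj₁ (≤B-refl λ v → trans (act-snoc x s v) (trans (x≈y (sref s v)) (sym (act-snoc y s v))))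
  ≤B-snocʳ {y = y} s (≤B-step {w = w} t x≤w r shorter wt≈y) with edge-snoc s (step-edge {t} {w} r shorter wt≈y)
  ... | inj₂ ws≈y = inj₂ (≤B-resp-≈ x≤w λ v →
    trans (sym (snoc-snoc w s v)) (trans (act-snoc (w ∷ʳ s) s v) (trans (ws≈y (sref s v)) (sym (act-snoc y s v)))))
  ... | inj₁ ws→ys with ≤B-snocʳ s x≤w
  ...   | inj₁ xs≤ws = inj₁ (≤B-edge xs≤ws ws→ys)
  ...   | inj₂ x≤ws = inj₂ (≤B-edge x≤ws ws→ys)

  snoc-ascent : ∀ x s → Nonneg (act x (e s)) → x ≤B (x ∷ʳ s)
  snoc-ascent x s 0≤xs = edge-≤B (edge (Root-e s) (Nonneg-e s) 0≤xs (Reflected-snoc x s))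

  snoc-descent : ∀ x s → Neg (act x (e s)) → (x ∷ʳ s) ≤B x
  snoc-descent x s xs≤0 = ≤B-resp-≈
    (snoc-ascent (x ∷ʳ s) s (subst Nonneg (sym (act-snoc-e x s)) xs≤0)) (snoc-snoc x s)

  -- The classical lifting property: the ascent at `x` and the descent at `y` bring both
  -- alternatives of `≤B-snocˡ` and `≤B-snocʳ` to the same conclusion.
  lifting : ∀ s → x ≤B y → Nonneg (act x (e s)) → Neg (act y (e s)) → (x ∷ʳ s) ≤B y × x ≤B (y ∷ʳ s)
  lifting {x} {y} s x≤y 0≤xs ys≤0 =
    [ (λ xs≤ys → ≤B-trans xs≤ys (snoc-descent y s ys≤0)) , (λ xs≤y → xs≤y) ] (≤B-snocˡ s x≤y) ,
    [ (λ xs≤ys → ≤B-trans (snoc-ascent x s 0≤xs) xs≤ys) , (λ x≤ys → x≤ys) ] (≤B-snocʳ s x≤y)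

  -- A descent at `x` absorbs the second alternative of `≤B-snocʳ`, and an ascent at `y` that of
  -- `≤B-snocˡ`; only `s` in AD(x, y) escapes both.
  ≤B-snoc : ∀ s → x ≤B y → (Nonneg (act x (e s)) → ¬ Neg (act y (e s))) → (x ∷ʳ s) ≤B (y ∷ʳ s)
  ≤B-snoc {x} {y} s x≤y ¬AD with root-sign (Root-act x (Root-e s)) | root-sign (Root-act y (Root-e s))
  ... | inj₂ xs≤0 | _ = [ (λ xs≤ys → xs≤ys) , ≤B-trans (snoc-descent x s xs≤0) ] (≤B-snocʳ s x≤y)
  ... | inj₁ _ | inj₁ 0≤ys = [ (λ xs≤ys → xs≤ys) , (λ xs≤y → ≤B-trans xs≤y (snoc-ascent y s 0≤ys)) ] (≤B-snocˡ s x≤y)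
  ... | inj₁ 0≤xs | inj₂ ys≤0 = ⊥-elim (¬AD 0≤xs ys≤0)

  -- Splitting a positive root into two.

  -- A decomposition `a = b + c` into positive roots. The product 1 makes the reflection in `a`
  -- exchange `b` with `negV c`.
  record Split (a b c : Vect) : Set where
    field
      rootˡ : Root b
      nonnegˡ : Nonneg b
      rootʳ : Root c
      nonnegʳ : Nonneg c
      pairingˡ : B a b ≡ + 1
      remainder : c ≡ subV a b
  open Split

  Split-swap : Root a → Split a b c → Split a c b
  Split-swap {a} {b} {c} ra d = record
    { rootˡ = rootʳ d ; nonnegˡ = nonnegʳ d ; rootʳ = rootˡ d ; nonnegʳ = nonnegˡ d
    ; pairingˡ = trans (cong (B a) (remainder d)) (trans (B-subVʳ a a b) (cong₂ _-_ {B a a} {+ 2} {B a b} {+ 1} (Root-norm ra) (pairingˡ d)))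
    ; remainder = lookup-ext λ i → sym (trans (lookup-zipWith _-_ i a c)
        (trans (cong (λ z → lookup a i - z) (trans (cong (λ z → lookup z i) (remainder d)) (lookup-zipWith _-_ i a b)))
          (ring (lookup a i) (lookup b i)))) }
    where
    ring : ∀ p q → p - (p - q) ≡ q
    ring = solve-∀

  Split-refl : Split a b c → refl[ a ] b ≡ negV c
  Split-refl {a} {b} {c} d = lookup-ext λ i → begin
    lookup (b ⊖ B a b · a) i                  ≡⟨ lookup-⊖ b (B a b) a i ⟩
    lookup b i - B a b * lookup a i           ≡⟨ cong (λ m → lookup b i - m * lookup a i) (pairingˡ d) ⟩
    lookup b i - + 1 * lookup a i             ≡⟨ ring (lookup a i) (lookup b i) ⟩
    - (lookup a i - lookup b i)               ≡⟨ cong -_ (lookup-zipWith _-_ i a b) ⟨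
    - lookup (subV a b) i                     ≡⟨ cong (λ v → - lookup v i) (remainder d) ⟨
    - lookup c i                              ≡⟨ lookup-map i _ c ⟨
    lookup (negV c) i                         ∎
    where
    open ≡-Reasoning
    ring : ∀ p q → q - + 1 * p ≡ - (p - q)
    ring = solve-∀

  Split-Reflected : Split a b c → Reflected x a y → act y b ≡ negV (act x c)
  Split-Reflected {b = b} {c} {x} d xy = trans (xy b) (trans (cong (act x) (Split-refl d)) (act-negV x c))

  Split-act : ∀ x → Split a b c → act x c ≡ subV (act x a) (act x b)
  Split-act {a} {b} x d = trans (cong (act x) (remainder d)) (act-subV x a b)

  Split-nonneg : ∀ x → Split a b c → Nonneg (act x a) → Neg (act x b) → Nonneg (act x c)
  Split-nonneg x d 0≤xa xb≤0 = subst Nonneg (sym (Split-act x d)) (Nonneg-subV 0≤xa xb≤0)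

  Split-neg : ∀ x → Split a b c → Neg (act x a) → Nonneg (act x b) → Neg (act x c)
  Split-neg x d xa≤0 0≤xb = subst Neg (sym (Split-act x d)) (Neg-subV xa≤0 0≤xb)

  Split-climb : ∀ s → Root a → Nonneg a → B (e s) a ≡ - + 1 → Split (sref s a) (e s) a
  Split-climb {a} s ra 0≤a sa = record
    { rootˡ = Root-e s ; nonnegˡ = Nonneg-e s ; rootʳ = ra ; nonnegʳ = 0≤a
    ; pairingˡ = trans (B-sym (sref s a) (e s)) (sref-flip s sa)
    ; remainder = lookup-ext λ i → sym (trans (lookup-zipWith _-_ i (sref s a) (e s))
        (trans (cong (λ v → lookup v i - lookup (e s) i) (sref≡refl s a))
          (trans (cong (λ z → z - lookup (e s) i) (trans (lookup-⊖ a (B (e s) a) (e s) i)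
              (cong (λ m → lookup a i - m * lookup (e s) i) sa)))
            (ring (lookup a i) (lookup (e s) i))))) }
    where
    ring : ∀ p q → p - (- + 1) * q - q ≡ p
    ring = solve-∀

  -- Both summands have product 1 with `a`, whereas `e s` has product -1; neither is `e s`, so both
  -- stay positive under `s`.
  Split-sref : ∀ s → Root a → B (e s) a ≡ - + 1 → Split a b c → Split (sref s a) (sref s b) (sref s c)
  Split-sref {a} {b} {c} s ra sa d = record
    { rootˡ = Root-act (s ∷ []) (rootˡ d)
    ; nonnegˡ = sref-nonneg (rootˡ d) (nonnegˡ d) (nonsimple d)
    ; rootʳ = Root-act (s ∷ []) (rootʳ d)
    ; nonnegʳ = sref-nonneg (rootʳ d) (nonnegʳ d) (nonsimple (Split-swap ra d))
    ; pairingˡ = trans (B-sref s a b) (pairingˡ d)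
    ; remainder = Split-act (s ∷ []) d }
    where
    nonsimple : ∀ {b c} → Split a b c → b ≢ e s
    nonsimple d refl = case trans (sym (pairingˡ d)) (trans (B-sym a (e s)) sa) of λ ()

  -- Reflections that raise the length by one.

  -- Induction on depth, conjugating by `s`: the length changes from `x` to `x ∷ʳ s` and from
  -- `y ∷ʳ s` back to `y` must cancel. They fail to do so only if `e s` and `a` both have positive
  -- image, which the split hypothesis forbids.
  cover-length : Depth a → Root a → Nonneg (act x a) →
    (∀ {b c} → Split a b c → Nonneg (act x b) → ¬ Nonneg (act x c)) →
    Reflected x a y → Len x k → Len y (suc k)
  cover-length {x = x} {y} (simple s) _ 0≤xs _ xy lx = Len-up {x = x} {y = y} 0≤xs xy lx
  cover-length {x = x} {y} {k} (climb s {a} ra 0≤a sa d) rsa 0≤xsa unsplit xy lx =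
    result (root-sign (Root-act x (Root-e s))) (root-sign (Root-act x ra))
    where
    split : Split (sref s a) (e s) a
    split = Split-climb s ra 0≤a sa
    recurse : ∀ {m} → Len (x ∷ʳ s) m → Len (y ∷ʳ s) (suc m)
    recurse = cover-length {x = x ∷ʳ s} {y ∷ʳ s} d ra (subst Nonneg (sym (act-snoc x s a)) 0≤xsa)
      (λ {b} {c} d′ 0≤xsb 0≤xsc → unsplit (Split-sref s ra sa d′)
        (subst Nonneg (act-snoc x s b) 0≤xsb) (subst Nonneg (act-snoc x s c) 0≤xsc))
      (Reflected-conjugate {x} {s} {a} {y} xy)
    -- The reflection in `sref s a` sends `e s` to `negV a`, so the sign of `act x a` decides the
    -- step from `y ∷ʳ s` back to `y`.
    ys-image : act (y ∷ʳ s) (e s) ≡ act x a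
    ys-image = trans (act-snoc-e y s) (trans (cong negV (Split-Reflected {x = x} {y} split xy)) (negV-involutive (act x a)))
    ys-y : Reflected (y ∷ʳ s) (e s) y
    ys-y = Reflected-sym {x = y} {y ∷ʳ s} (Root-e s) (Reflected-snoc y s)
    ascend : Neg (act x a) → Len (x ∷ʳ s) (suc k) → Len y (suc k)
    ascend xa≤0 lxs = shed (Len-down {x = y ∷ʳ s} {s} {y} (subst Neg (sym ys-image) xa≤0) ys-y (recurse lxs))
      where
      shed : ∃[ m ] (suc (suc k) ≡ suc m × Len y m) → Len y (suc k)
      shed (_ , refl , ly) = ly
    descend : Nonneg (act x a) → ∃[ m ] (k ≡ suc m × Len (x ∷ʳ s) m) → Len y (suc k)
    descend 0≤xa (m , refl , lxs) = Len-up {x = y ∷ʳ s} {s} {y} (subst Nonneg (sym ys-image) 0≤xa) ys-y (recurse lxs)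
    result : Nonneg (act x (e s)) ⊎ Neg (act x (e s)) → Nonneg (act x a) ⊎ Neg (act x a) → Len y (suc k)
    result (inj₁ 0≤xs) (inj₁ 0≤xa) = ⊥-elim (unsplit split 0≤xs 0≤xa)
    result (inj₁ 0≤xs) (inj₂ xa≤0) = ascend xa≤0 (Len-up {x = x} {s} {x ∷ʳ s} 0≤xs (Reflected-snoc x s) lx)
    -- The image of `e s + a` is positive and that of `e s` negative, which forces the image of `a`
    -- to be positive.
    result (inj₂ xs≤0) _ = descend (Split-nonneg x split 0≤xsa xs≤0) (Len-down {x = x} {s} {x ∷ʳ s} xs≤0 (Reflected-snoc x s) lx)

  -- Reflecting the ends of a Bruhat interval.

  -- The simple case is `lifting`. Otherwise the split hypothesis, applied to `e s`, permits
  -- multiplying `x` and `y` by `s`; applied to `a`, it permits cancelling `s` afterwards.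
  reflect-between : Depth a → Root a → x ≤B y → Nonneg (act x a) → Neg (act y a) →
    (∀ {b c} → Split a b c → Nonneg (act x b) → ¬ Neg (act y b)) →
    ∀ {x₁ y₁} → Reflected x a x₁ → Reflected y a y₁ → x₁ ≤B y × x ≤B y₁
  reflect-between {x = x} {y} (simple s) _ x≤y 0≤xs ys≤0 _ {x₁} {y₁} xx₁ yy₁ =
    ≤B-trans {y = x ∷ʳ s} (≤B-refl λ v → trans (xx₁ v) (sym (Reflected-snoc x s v))) (proj₁ lifted) ,
    ≤B-resp-≈ {y = y ∷ʳ s} (proj₂ lifted) λ v → trans (Reflected-snoc y s v) (sym (yy₁ v))
    where
    lifted : (x ∷ʳ s) ≤B y × x ≤B (y ∷ʳ s)
    lifted = lifting s x≤y 0≤xs ys≤0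
  reflect-between {x = x} {y} (climb s {a} ra 0≤a sa d) rsa x≤y 0≤xsa ysa≤0 none {x₁} {y₁} xx₁ yy₁ =
    -- An obstruction makes `act x a` positive and `act y (e s)` positive. As `y` negates the sum
    -- `e s + a`, it would negate `a`.
    strip {x₁} {y} (proj₁ shifted) (λ 0≤ ≤0 → straddles
      (subst Nonneg (x₁-image x x₁ xx₁) 0≤)
      (Split-neg y split ysa≤0 (subst Nonneg (negV-involutive (act y (e s))) (subst Neg (act-snoc-e y s) ≤0)))) ,
    -- Dually, an obstruction makes `act x (e s)` negative, hence `act x a` positive, while
    -- `act y a` is negative.
    strip {x} {y₁} (proj₂ shifted) (λ 0≤ ≤0 → straddles
      (Split-nonneg x split 0≤xsa (subst Nonneg (act-snoc-e x s) 0≤))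
      (subst Neg (x₁-image y y₁ yy₁) ≤0))
    where
    split : Split (sref s a) (e s) a
    split = Split-climb s ra 0≤a sa
    straddles : Nonneg (act x a) → ¬ Neg (act y a)
    straddles = none (Split-swap rsa split)
    x₁-image : ∀ x x₁ → Reflected x (sref s a) x₁ → act (x₁ ∷ʳ s) (e s) ≡ act x a
    x₁-image x x₁ xx₁ = trans (act-snoc-e x₁ s) (trans (cong negV (Split-Reflected {x = x} {x₁} split xx₁)) (negV-involutive (act x a)))
    shifted : (x₁ ∷ʳ s) ≤B (y ∷ʳ s) × (x ∷ʳ s) ≤B (y₁ ∷ʳ s)
    shifted = reflect-between {x = x ∷ʳ s} {y ∷ʳ s} d ra (≤B-snoc {x} {y} s x≤y (none split))
      (subst Nonneg (sym (act-snoc x s a)) 0≤xsa) (subst Neg (sym (act-snoc y s a)) ysa≤0)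
      (λ {b} {c} d′ 0≤xsb ysb≤0 → none (Split-sref s ra sa d′)
        (subst Nonneg (act-snoc x s b) 0≤xsb) (subst Neg (act-snoc y s b) ysb≤0))
      {x₁ ∷ʳ s} {y₁ ∷ʳ s} (Reflected-conjugate {x} {s} {a} {x₁} xx₁) (Reflected-conjugate {y} {s} {a} {y₁} yy₁)
    strip : ∀ {p q} → (p ∷ʳ s) ≤B (q ∷ʳ s) →
      (Nonneg (act (p ∷ʳ s) (e s)) → ¬ Neg (act (q ∷ʳ s) (e s))) → p ≤B q
    strip {p} {q} ps≤qs ¬AD = ≤B-trans {y = (p ∷ʳ s) ∷ʳ s} (≤B-refl λ v → sym (snoc-snoc p s v))
      (≤B-resp-≈ {y = (q ∷ʳ s) ∷ʳ s} (≤B-snoc {p ∷ʳ s} {q ∷ʳ s} s ps≤qs ¬AD) (snoc-snoc q s))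

  -- Consequences of minimality.

  edge-<B : Edge x y → x <B y
  edge-<B {x} {y} xy = edge-≤B xy , λ x≈y → ℕₚ.<-irrefl refl
    (edge-Len xy (proj₂ (Len-exists x)) (Len-cong {x} {y} x≈y (proj₂ (Len-exists x))))

  edge-≰B : Edge x y → ¬ y ≤B x
  edge-≰B {x} {y} xy y≤x = ℕₚ.<⇒≱ (edge-Len xy (proj₂ (Len-exists x)) (proj₂ (Len-exists y)))
    (≤B-Len y≤x (proj₂ (Len-exists y)) (proj₂ (Len-exists x)))

  generalized-lifting : (u v t : Word) → MinimalAD u v t → u ≤B v →
    (u ⊲ (u ++ t)) × ((u ++ t) ≤B v) × (u ≤B (v ++ t)) × ((v ++ t) ⊲ v)
  generalized-lifting u v t (((t-refl , u<ut) , (_ , vt<v)) , minimal) u≤v with positiveRoot {t} t-refl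
  ... | a , ra , at@(0≤a , _) , t≈ =
    (u<ut , _ , lenu , cover-length {x = u} {u ++ t} da ra 0≤ua u-unsplit ut lenu) ,
    proj₁ between , proj₂ between ,
    -- The lower cover is read upwards: the reflection `t` leads from `v ++ t` to `v`.
    (vt<v , _ , lenvt , cover-length {x = v ++ t} {v} da ra 0≤vta v-unsplit (Reflected-sym {x = v} {v ++ t} ra vt) lenvt)
    where
    da : Depth a
    da = depth ra 0≤a
    lenu = proj₂ (Len-exists u)
    lenvt = proj₂ (Len-exists (v ++ t))
    ut : Reflected u a (u ++ t)
    ut = Reflected-++ {t} t≈ u
    vt : Reflected v a (v ++ t)
    vt = Reflected-++ {t} t≈ v
    0≤ua : Nonneg (act u a)
    0≤ua with root-sign (Root-act u ra)
    ... | inj₁ 0≤ = 0≤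
    ... | inj₂ ≤0 = ⊥-elim (edge-≰B {u ++ t} {u} (edge ra 0≤a
      (subst Nonneg (sym (Reflected-negates {x = u} {u ++ t} ra ut)) ≤0) (Reflected-sym {x = u} {u ++ t} ra ut)) (proj₁ u<ut))
    va≤0 : Neg (act v a)
    va≤0 with root-sign (Root-act v ra)
    ... | inj₂ ≤0 = ≤0
    ... | inj₁ 0≤ = ⊥-elim (edge-≰B {v} {v ++ t} (edge ra 0≤a 0≤ vt) (proj₁ vt<v))
    0≤vta : Nonneg (act (v ++ t) a)
    0≤vta = subst Nonneg (sym (Reflected-negates {x = v} {v ++ t} ra vt)) va≤0

    -- Since `a - b = c` is nonnegative, the reflection `r` in such a `b` would lie in AD(u, v)
    -- below `t`, and minimality would give `r = t`.
    none : ∀ {b c} → Split a b c → Nonneg (act u b) → ¬ Neg (act v b)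
    none {b} {c} d 0≤ub vb≤0 = case pairings of λ ()
      where
      r : Word
      r = rootWord (rootˡ d)
      r≈ : ∀ z → act r z ≡ refl[ b ] z
      r≈ = act-rootWord (rootˡ d)
      r-refl : IsRefl r
      r-refl = proj₁ (rootˡ d) , proj₁ (proj₂ (rootˡ d)) , λ _ → refl
      vr : Reflected v b (v ++ r)
      vr = Reflected-++ {r} r≈ v
      rAD : InAD u v r
      rAD = (r-refl , edge-<B {u} {u ++ r} (edge (rootˡ d) (nonnegˡ d) 0≤ub (Reflected-++ {r} r≈ u))) ,
            (r-refl , edge-<B {v ++ r} {v} (edge (rootˡ d) (nonnegˡ d)
              (subst Nonneg (sym (Reflected-negates {x = v} {v ++ r} (rootˡ d) vr)) vb≤0) (Reflected-sym {x = v} {v ++ r} (rootˡ d) vr)))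
      br : RootOf r b
      br = nonnegˡ d , proj₁ (rootˡ d) , proj₁ (proj₂ (rootˡ d)) , (λ _ → refl) , inj₁ (proj₂ (proj₂ (rootˡ d)))
      r⪯t : r ⪯ t
      r⪯t = b , a , br , at , subst Nonneg (remainder d) (nonnegʳ d)
      refl≡negV : refl[ b ] a ≡ negV a
      refl≡negV = trans (sym (r≈ a)) (trans (minimal r rAD r⪯t a) (trans (t≈ a) (refl-self ra)))
      ba : B b a ≡ + 1
      ba = trans (B-sym b a) (pairingˡ d)
      pairings : + 1 ≡ - + 2
      -- The product of `a` with `refl[ b ] a` is `2 - 1 * 1`, but it would be -2 if `r` and `t`
      -- agreed.
      pairings = begin
        + 1                          ≡⟨⟩
        + 2 - + 1 * + 1              ≡⟨ cong₂ (λ p q → p - q * + 1) {B a a} {+ 2} {B b a} {+ 1} (Root-norm ra) ba ⟨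
        B a a - B b a * + 1          ≡⟨ cong (λ p → B a a - B b a * p) (pairingˡ d) ⟨
        B a a - B b a * B a b        ≡⟨ B-⊖ʳ a a (B b a) b ⟨
        B a (refl[ b ] a)            ≡⟨ cong (B a) refl≡negV ⟩
        B a (negV a)                 ≡⟨ B-negVʳ a a ⟩
        - B a a                      ≡⟨ cong -_ (Root-norm ra) ⟩
        - + 2                        ∎
        where open ≡-Reasoning

    -- As `v` negates `a = b + c`, it negates a summand; with both images under `u` positive, that
    -- summand contradicts `none`.
    u-unsplit : ∀ {b c} → Split a b c → Nonneg (act u b) → ¬ Nonneg (act u c)
    u-unsplit d 0≤ub 0≤uc with root-sign (Root-act v (rootˡ d))
    ... | inj₁ 0≤vb = none (Split-swap ra d) 0≤uc (Split-neg v d va≤0 0≤vb)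
    ... | inj₂ vb≤0 = none d 0≤ub vb≤0

    -- Through `t`, positivity of both images under `v ++ t` says that `v` negates both `b` and `c`;
    -- since `act u a` is positive, `u` keeps one of them positive.
    v-unsplit : ∀ {b c} → Split a b c → Nonneg (act (v ++ t) b) → ¬ Nonneg (act (v ++ t) c)
    v-unsplit d 0≤vtb 0≤vtc with root-sign (Root-act u (rootˡ d))
    ... | inj₁ 0≤ub = none d 0≤ub (subst Nonneg (Split-Reflected {x = v} {v ++ t} (Split-swap ra d) vt) 0≤vtc)
    ... | inj₂ ub≤0 = none (Split-swap ra d) (Split-nonneg u d 0≤ua ub≤0)
      (subst Nonneg (Split-Reflected {x = v} {v ++ t} d vt) 0≤vtb)

    between : (u ++ t) ≤B v × u ≤B (v ++ t)
    between = reflect-between da ra u≤v 0≤ua va≤0 none ut vt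

theorem6p3 : (n : ℕ) (M : CoxMat n) →
    let open Coxeter M in
    IsSimplyLaced → FiniteW →
    (u v t : Word) → u <B v → MinimalAD u v t →
    (u ⊲ (u ++ t)) × ((u ++ t) ≤B v) × (u ≤B (v ++ t)) × ((v ++ t) ⊲ v)
theorem6p3 n M simplyLaced finite u v t u<v minimal =
  Roots.generalized-lifting M simplyLaced finite u v t minimal (proj₁ u<v)
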